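{- For nonnegative integers $n$ and $k$, let $a_{n,k}^{(3)}$ denote the number of integer points $(x_1,x_2,x_3)\in\mathbb{Z}^3$ such that $\max_{1\leq i\leq 3}|x_i|\leq k$ and $|x_1|+|x_2|+|x_3|\leq n$. Then \[a_{n,k}^{(3)}=\frac13\begin{cases} 4n^3+6n^2+8n+3, & \text{if } 0\leq n<k;\\ 12k^3-36k^2n+36kn^2-8n^3+6n^2+6k+2n+3, & \text{if } k\leq n<2k;\\ -84k^3+108k^2n-36kn^2+4n^3-72k^2+72nk-12n^2-6k+8n+3, & \text{if } 2k\leq n<3k;\\ 24k^3+36k^2+18k+3, & \text{otherwise}. \end{cases}\] -}

module Defs where

open import Data.Bool using (if_then_else_; _∧_)
open import Data.Integer using (ℤ; +_; -[1+_]; ∣_∣; -_; _+_; _-_; _*_; _^_)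
open import Data.Integer.Properties using (+-injective)
open import Data.List using (List; map; _++_; upTo; filter; length; cartesianProduct)
open import Data.List.Membership.Propositional using (_∈_)
open import Data.List.Membership.Propositional.Properties
  using (∈-map⁺; ∈-map⁻; ∈-++⁺ˡ; ∈-++⁺ʳ; ∈-upTo⁺; ∈-cartesianProduct⁺; ∈-filter⁺; ∈-filter⁻)
open import Data.List.Relation.Unary.Unique.Propositional using (Unique)
import Data.List.Relation.Unary.Unique.Propositional.Properties as Unique
open import Data.Nat as ℕ using (ℕ; suc; s≤s; _⊔_; _≤_; _≤?_; _<?_)
open import Data.Nat.Properties using (m⊔n≤o⇒m≤o; m⊔n≤o⇒n≤o)
open import Data.Product using (_×_; _,_; proj₂)
open import Function using (_⇔_; mk⇔)
open import Relation.Binary.PropositionalEquality using (refl)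
open import Relation.Nullary using (Dec)
open import Relation.Nullary.Decidable using (_×-dec_; ⌊_⌋)

ℤ³ : Set
ℤ³ = ℤ × ℤ × ℤ

InRegion : ℕ → ℕ → ℤ³ → Set
InRegion n k (x₁ , x₂ , x₃) =
  (∣ x₁ ∣ ⊔ ∣ x₂ ∣ ⊔ ∣ x₃ ∣ ≤ k) × (∣ x₁ ∣ ℕ.+ ∣ x₂ ∣ ℕ.+ ∣ x₃ ∣ ≤ n)

inRegion? : ∀ n k x → Dec (InRegion n k x)
inRegion? n k (x₁ , x₂ , x₃) =
  (∣ x₁ ∣ ⊔ ∣ x₂ ∣ ⊔ ∣ x₃ ∣ ≤? k) ×-dec (∣ x₁ ∣ ℕ.+ ∣ x₂ ∣ ℕ.+ ∣ x₃ ∣ ≤? n)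

-- 0, 1, …, k, -1, …, -k
interval : ℕ → List ℤ
interval k = map +_ (upTo (suc k)) ++ map -[1+_] (upTo k)

cube : ℕ → List ℤ³
cube k = cartesianProduct (interval k) (cartesianProduct (interval k) (interval k))

-- Filtering the finite cube lists every point of the region exactly once:
-- see ∈-points and points-unique.
points : ℕ → ℕ → List ℤ³
points n k = filter (inRegion? n k) (cube k)

a⁽³⁾ : ℕ → ℕ → ℕ
a⁽³⁾ n k = length (points n k)

formula : ℕ → ℕ → ℤ
formula n k =
  if ⌊ n <? k ⌋ then
    + 4 * N ^ 3 + + 6 * N ^ 2 + + 8 * N + + 3
  else if ⌊ k ≤? n ⌋ ∧ ⌊ n <? 2 ℕ.* k ⌋ then
    + 12 * K ^ 3 - + 36 * K ^ 2 * N + + 36 * K * N ^ 2 - + 8 * N ^ 3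
      + + 6 * N ^ 2 + + 6 * K + + 2 * N + + 3
  else if ⌊ 2 ℕ.* k ≤? n ⌋ ∧ ⌊ n <? 3 ℕ.* k ⌋ then
    - (+ 84) * K ^ 3 + + 108 * K ^ 2 * N - + 36 * K * N ^ 2 + + 4 * N ^ 3
      - + 72 * K ^ 2 + + 72 * N * K - + 12 * N ^ 2 - + 6 * K + + 8 * N + + 3
  else
    + 24 * K ^ 3 + + 36 * K ^ 2 + + 18 * K + + 3
  where
  N = + n
  K = + k

∈-interval : ∀ {k} x → ∣ x ∣ ≤ k → x ∈ interval k
∈-interval (+ m)      m≤k = ∈-++⁺ˡ (∈-map⁺ +_ (∈-upTo⁺ (s≤s m≤k)))
∈-interval (-[1+ m ]) m<k = ∈-++⁺ʳ (map +_ _) (∈-map⁺ -[1+_] (∈-upTo⁺ m<k))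

interval-unique : ∀ k → Unique (interval k)
interval-unique k = Unique.++⁺
  (Unique.map⁺ +-injective (Unique.upTo⁺ (suc k)))
  (Unique.map⁺ (λ { refl → refl }) (Unique.upTo⁺ k))
  disjoint
  where
  disjoint : ∀ {x} → x ∈ map +_ (upTo (suc k)) × x ∈ map -[1+_] (upTo k) → _
  disjoint (p , q) with ∈-map⁻ +_ p | ∈-map⁻ -[1+_] q
  ... | _ , _ , refl | _ , _ , ()

∈-points : ∀ n k x → x ∈ points n k ⇔ InRegion n k x
∈-points n k x = mk⇔ (λ p → proj₂ (∈-filter⁻ (inRegion? n k) {xs = cube k} p)) (complete x)
  where
  complete : ∀ x → InRegion n k x → x ∈ points n k
  complete (x₁ , x₂ , x₃) r@(max≤k , _) = ∈-filter⁺ (inRegion? n k)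
    (∈-cartesianProduct⁺ (∈-interval x₁ (m⊔n≤o⇒m≤o ∣ x₁ ∣ ∣ x₂ ∣ m₁₂))
      (∈-cartesianProduct⁺ (∈-interval x₂ (m⊔n≤o⇒n≤o ∣ x₁ ∣ ∣ x₂ ∣ m₁₂))
        (∈-interval x₃ (m⊔n≤o⇒n≤o (∣ x₁ ∣ ⊔ ∣ x₂ ∣) ∣ x₃ ∣ max≤k))))
    r
    where m₁₂ = m⊔n≤o⇒m≤o (∣ x₁ ∣ ⊔ ∣ x₂ ∣) ∣ x₃ ∣ max≤k

points-unique : ∀ n k → Unique (points n k)
points-unique n k = Unique.filter⁺ (inRegion? n k)
  (Unique.cartesianProduct⁺ (interval-unique k)
    (Unique.cartesianProduct⁺ (interval-unique k) (interval-unique k)))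

{-# OPTIONS --safe #-}
-- Slicing by the first coordinate, the number c_{d+1}(n) of points with max |x_i| ≤ k and
-- |x_1| + … + |x_{d+1}| ≤ n is the sum of c_d(n - |x|) over |x| ≤ min(k, n), which is
-- c_d(n) + 2 (S(n) - S(n ∸ k)) for S(m) the sum of c_d(i) over i < m. A polynomial vanishing at 0
-- may be summed after the truncated shift m ↦ m ∸ k as if there were no shift, so each c_d is a
-- polynomial in n, n ∸ k, …, n ∸ d k. The four cases of the formula correspond to which of these
-- differences are truncated.
module Submission where

open import Defs
open import Data.Nat using (ℕ)
open import Data.Integer using (+_)
open import Relation.Binary.PropositionalEquality using (_≡_)

open import Data.Integer using (ℤ; ∣_∣; -[1+_])
import Data.Integer.Properties as ℤ
open import Data.Integer.Tactic.RingSolver using (solve-∀)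
open import Data.List using (List; []; _∷_; [_]; map; _++_; applyUpTo; upTo; filter; length; cartesianProduct)
open import Data.List.Properties
  using (filter-++; filter-none; filter-≐; length-++; map-++; map-∘; map-cong; map-upTo)
open import Data.List.Membership.Propositional.Properties using (∈-cartesianProduct⁻)
open import Data.List.Relation.Unary.All using (All; []; _∷_; lookup; tabulate; universal)
import Data.List.Relation.Unary.All.Properties as All
open import Data.Nat as ℕ using (zero; suc; s≤s; s≤s⁻¹; _∸_; _≤_; _≤?_; _<?_)
open import Data.Nat.ListAction using (sum)
open import Data.Nat.ListAction.Properties using (sum-++)
import Data.Nat.Properties as ℕ
open import Data.Product using (_,_; _×_)
open import Data.Rational using (toℚᵘ)
open import Data.Rational.Properties using (toℚᵘ-injective; toℚᵘ-fromℚᵘ; toℚᵘ-homo-*)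
open import Data.Rational.Unnormalised as ℚᵘ using (mkℚᵘ; *≡*)
import Data.Rational.Unnormalised.Properties as ℚᵘ
open import Function using (_∘_; _⇔_; mk⇔; Equivalence)
open import Level using (Level)
open import Relation.Binary.PropositionalEquality using (refl; sym; trans; cong; cong₂; subst; module ≡-Reasoning)
open import Relation.Nullary using (yes; no; contradiction)
open import Relation.Unary using (Pred; Decidable)

open ≡-Reasoning

private variable
  a p q : Level
  A B : Set a

-- Counting the entries of a list that pass a test.

count : {P : Pred A p} → Decidable P → List A → ℕ
count P? xs = length (filter P? xs)

count-cong-local : {P : Pred A p} {Q : Pred A q} (P? : Decidable P) (Q? : Decidable Q) →
  ∀ {xs} → All (λ x → P x ⇔ Q x) xs → count P? xs ≡ count Q? xs
count-cong-local P? Q? [] = refl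
count-cong-local P? Q? {x ∷ _} (eq ∷ eqs) with P? x | Q? x
... | yes _  | yes _  = cong suc (count-cong-local P? Q? eqs)
... | no _   | no _   = count-cong-local P? Q? eqs
... | yes px | no ¬qx = contradiction (Equivalence.to eq px) ¬qx
... | no ¬px | yes qx = contradiction (Equivalence.from eq qx) ¬px

count-++ : {P : Pred A p} (P? : Decidable P) →
  ∀ xs ys → count P? (xs ++ ys) ≡ count P? xs ℕ.+ count P? ys
count-++ P? xs ys = trans (cong length (filter-++ P? xs ys)) (length-++ (filter P? xs))

count-map : {P : Pred B p} (P? : Decidable P) (f : A → B) →
  ∀ xs → count P? (map f xs) ≡ count (P? ∘ f) xs
count-map P? f [] = refl
count-map P? f (x ∷ xs) with P? (f x)
... | yes _ = cong suc (count-map P? f xs)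
... | no _  = count-map P? f xs

-- Puts the one-dimensional count in the shape of a sum over slices, each slice being a one-element
-- list, so that dimension one is handled like the higher ones.
count-singletons : {P : Pred A p} (P? : Decidable P) →
  ∀ xs → count P? xs ≡ sum (map (λ x → count (λ _ → P? x) [ x ]) xs)
count-singletons P? [] = refl
count-singletons P? (x ∷ xs) with P? x
... | yes _ = cong suc (count-singletons P? xs)
... | no _  = count-singletons P? xs

count-cartesianProduct : {P : Pred (A × B) p} (P? : Decidable P) →
  ∀ xs ys → count P? (cartesianProduct xs ys) ≡ sum (map (λ x → count (λ y → P? (x , y)) ys) xs)
count-cartesianProduct P? [] ys = refl
count-cartesianProduct P? (x ∷ xs) ys = trans
  (count-++ P? (map (x ,_) ys) (cartesianProduct xs ys))
  (cong₂ ℕ._+_ (count-map P? (x ,_) ys) (count-cartesianProduct P? xs ys))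

-- Delayed functions and sums over the interval.

-- F (n - i), with F extended by 0 to negative arguments.
delay : ℕ → (ℕ → ℕ) → ℕ → ℕ
delay zero    F n       = F n
delay (suc i) F zero    = 0
delay (suc i) F (suc n) = delay i F n

-- For i ≤ n the test is f x ≤ n - i; for i > n no entry passes, which is where `delay` returns 0.
count-shift : (f : A → ℕ) (xs : List A) → ∀ i n →
  count (λ x → i ℕ.+ f x ≤? n) xs ≡ delay i (λ m → count (λ x → f x ≤? m) xs) n
count-shift f xs zero    n       = refl
count-shift f xs (suc i) zero    = cong length (filter-none (λ x → suc i ℕ.+ f x ≤? 0) (universal (λ _ ()) xs))
count-shift f xs (suc i) (suc n) = trans
  (cong length (filter-≐ (λ x → suc i ℕ.+ f x ≤? suc n) (λ x → i ℕ.+ f x ≤? n) (s≤s⁻¹ , s≤s) xs))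
  (count-shift f xs i n)

count-[_] : (x : A) → ∀ i n → count (λ _ → i ≤? n) [ x ] ≡ delay i (λ _ → 1) n
count-[ x ] zero    n       = refl
count-[ x ] (suc i) zero    = refl
count-[ x ] (suc i) (suc n) = trans
  (cong length (filter-≐ (λ _ → suc i ≤? suc n) (λ _ → i ≤? n) (s≤s⁻¹ , s≤s) [ x ]))
  (count-[ x ] i n)

-- Zero occurs once in the interval, and every absolute value from 1 to k occurs twice, once for
-- each sign.
sum-map-interval : (H : ℕ → ℕ) → ∀ k →
  sum (map (H ∘ ∣_∣) (interval k)) ≡ (H 0 ℕ.+ sum (applyUpTo (H ∘ suc) k)) ℕ.+ sum (applyUpTo (H ∘ suc) k)
sum-map-interval H k = begin
  sum (map (H ∘ ∣_∣) (interval k))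
    ≡⟨ cong sum (map-++ (H ∘ ∣_∣) (map +_ (upTo (suc k))) _) ⟩
  sum (map (H ∘ ∣_∣) (map +_ (upTo (suc k))) ++ map (H ∘ ∣_∣) (map -[1+_] (upTo k)))
    ≡⟨ sum-++ (map (H ∘ ∣_∣) (map +_ (upTo (suc k)))) _ ⟩
  sum (map (H ∘ ∣_∣) (map +_ (upTo (suc k)))) ℕ.+ sum (map (H ∘ ∣_∣) (map -[1+_] (upTo k)))
    ≡⟨ cong₂ (λ xs ys → sum xs ℕ.+ sum ys) (map-∘ (upTo (suc k))) (map-∘ (upTo k)) ⟨
  sum (map H (upTo (suc k))) ℕ.+ sum (map (H ∘ suc) (upTo k))
    ≡⟨ cong₂ (λ xs ys → sum xs ℕ.+ sum ys) (map-upTo H (suc k)) (map-upTo (H ∘ suc) k) ⟩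
  sum (applyUpTo H (suc k)) ℕ.+ sum (applyUpTo (H ∘ suc) k) ∎

-- Slicing by the first coordinate.

module _ (k : ℕ) where

  -- Only the bound on the sum is tested, since the lists already enforce the bound on the maximum.
  -- The sum in `count₃` is associated to the right so that removing the first coordinate leaves the
  -- test of `count₂`.
  count₁ count₂ count₃ : ℕ → ℕ
  count₁ n = count (λ x → ∣ x ∣ ≤? n) (interval k)
  count₂ n = count (λ (x , y) → ∣ x ∣ ℕ.+ ∣ y ∣ ≤? n) (cartesianProduct (interval k) (interval k))
  count₃ n = count (λ (x , y , z) → ∣ x ∣ ℕ.+ (∣ y ∣ ℕ.+ ∣ z ∣) ≤? n) (cube k)

  -- The operator that takes the count in dimension d to the count in dimension d + 1; the count in
  -- dimension 0 is the constant 1.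
  layers : (ℕ → ℕ) → ℕ → ℕ
  layers F n = sum (map (λ x → delay (∣ x ∣) F n) (interval k))

  count₁-layers : ∀ n → count₁ n ≡ layers (λ _ → 1) n
  count₁-layers n = trans (count-singletons (λ x → ∣ x ∣ ≤? n) (interval k))
    (cong sum (map-cong (λ x → count-[ x ] (∣ x ∣) n) (interval k)))

  count-layers : (f : B → ℕ) (ys : List B) → ∀ n →
    count (λ (x , y) → ∣ x ∣ ℕ.+ f y ≤? n) (cartesianProduct (interval k) ys)
      ≡ layers (λ m → count (λ y → f y ≤? m) ys) n
  count-layers f ys n = trans (count-cartesianProduct _ (interval k) ys)
    (cong sum (map-cong (λ x → count-shift f ys (∣ x ∣) n) (interval k)))

  interval-bounded : All (λ x → ∣ x ∣ ≤ k) (interval k)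
  interval-bounded = All.++⁺
    (All.map⁺ (All.applyUpTo⁺₁ _ (suc k) s≤s⁻¹))
    -- `∣ -[1+ i ] ∣` is `suc i`, so `i < k` is already the required bound.
    (All.map⁺ (All.applyUpTo⁺₁ _ k λ i<k → i<k))

  a⁽³⁾≡count₃ : ∀ n → a⁽³⁾ n k ≡ count₃ n
  a⁽³⁾≡count₃ n = count-cong-local (inRegion? n k) (λ (x , y , z) → ∣ x ∣ ℕ.+ (∣ y ∣ ℕ.+ ∣ z ∣) ≤? n)
    (tabulate λ {(x , y , z)} xyz∈ →
      let x∈ , yz∈ = ∈-cartesianProduct⁻ (interval k) _ xyz∈
          y∈ , z∈  = ∈-cartesianProduct⁻ (interval k) _ yz∈
          bound    = lookup interval-bounded
          assoc    = ℕ.+-assoc (∣ x ∣) (∣ y ∣) (∣ z ∣)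
      in mk⇔ (λ (_ , ≤n) → subst (_≤ n) assoc ≤n)
             (λ ≤n → ℕ.⊔-lub (ℕ.⊔-lub (bound x∈) (bound y∈)) (bound z∈) , subst (_≤ n) (sym assoc) ≤n))

-- Telescoping sums.

module _ where
  open import Data.Integer using (_+_; _*_; _-_; -_)

  -- The nonzero delayed values are among the F i with n ∸ k ≤ i < n, and S is an antidifference of
  -- c F. The factor c clears denominators, so that S can take integer values.
  sum-delay-telescopes : (c : ℤ) (F : ℕ → ℕ) (S : ℕ → ℤ) → (∀ m → S (suc m) ≡ S m + c * + F m) →
    ∀ k n → c * + sum (applyUpTo (λ i → delay (suc i) F n) k) ≡ S n - S (n ∸ k)
  sum-delay-telescopes c F S step zero n = trans (ℤ.*-zeroʳ c) (sym (ℤ.+-inverseʳ (S n)))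
  sum-delay-telescopes c F S step (suc k) zero = begin
    c * + sum (applyUpTo (λ _ → 0) (suc k)) ≡⟨ cong (λ s → c * + s) (sum-zeros (suc k)) ⟩
    c * + 0                                ≡⟨ ℤ.*-zeroʳ c ⟩
    + 0                                    ≡⟨ ℤ.+-inverseʳ (S 0) ⟨
    S 0 - S 0                              ∎
    where
    sum-zeros : ∀ j → sum (applyUpTo (λ _ → 0) j) ≡ 0
    sum-zeros zero    = refl
    sum-zeros (suc j) = sum-zeros j
  sum-delay-telescopes c F S step (suc k) (suc n) = begin
    c * (+ F n + + rest)               ≡⟨ ℤ.*-distribˡ-+ c (+ F n) (+ rest) ⟩
    c * + F n + c * + rest             ≡⟨ cong (λ t → c * + F n + t) (sum-delay-telescopes c F S step k n) ⟩
    c * + F n + (S n - S (n ∸ k))      ≡⟨ regroup (c * + F n) (S n) (S (n ∸ k)) ⟩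
    S n + c * + F n - S (n ∸ k)        ≡⟨ cong (λ t → t - S (n ∸ k)) (step n) ⟨
    S (suc n) - S (n ∸ k)              ∎
    where
    rest = sum (applyUpTo (λ i → delay (suc i) F n) k)
    regroup : ∀ x y z → x + (y - z) ≡ y + x - z
    regroup = solve-∀

  layers-formula : (c : ℤ) (F : ℕ → ℕ) (S : ℕ → ℤ) → (∀ m → S (suc m) ≡ S m + c * + F m) →
    ∀ k n → c * + layers k F n ≡ c * + F n + + 2 * (S n - S (n ∸ k))
  layers-formula c F S step k n = begin
    c * + layers k F n                     ≡⟨ cong (λ s → c * + s) (sum-map-interval (λ i → delay i F n) k) ⟩
    c * (+ F n + + tail + + tail)          ≡⟨ regroup c (+ F n) (+ tail) ⟩
    c * + F n + + 2 * (c * + tail)         ≡⟨ cong (λ t → c * + F n + + 2 * t) (sum-delay-telescopes c F S step k n) ⟩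
    c * + F n + + 2 * (S n - S (n ∸ k))    ∎
    where
    tail = sum (applyUpTo (λ i → delay (suc i) F n) k)
    regroup : ∀ x y z → x * (y + z + z) ≡ x * y + + 2 * (x * z)
    regroup = solve-∀

  -- g 0 ≡ 0 absorbs the steps at which the difference is still truncated to 0.
  ∸-telescope : (G g : ℤ → ℤ) → (∀ x → G (+ 1 + x) ≡ G x + g x) → g (+ 0) ≡ + 0 →
    ∀ m k → G (+ (suc m ∸ k)) ≡ G (+ (m ∸ k)) + g (+ (m ∸ k))
  ∸-telescope G g step g0 m zero = step (+ m)
  ∸-telescope G g step g0 zero (suc k) rewrite ℕ.0∸n≡0 k = sym (trans (cong (λ t → G (+ 0) + t) g0) (ℤ.+-identityʳ _))
  ∸-telescope G g step g0 (suc m) (suc k) = ∸-telescope G g step g0 m k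

  -- Closed forms in dimensions one, two and three.

  count₁-formula : ∀ k n → + count₁ k n ≡ + 2 * + n + + 1 - + 2 * + (n ∸ k)
  count₁-formula k n = begin
    + count₁ k n                            ≡⟨ cong +_ (count₁-layers k n) ⟩
    + layers k (λ _ → 1) n                  ≡⟨ ℤ.*-identityˡ _ ⟨
    + 1 * + layers k (λ _ → 1) n            ≡⟨ layers-formula (+ 1) (λ _ → 1) +_ (λ m → ℤ.+-comm (+ 1) (+ m)) k n ⟩
    + 1 * + 1 + + 2 * (+ n - + (n ∸ k))     ≡⟨ poly (+ n) (+ (n ∸ k)) ⟩
    + 2 * + n + + 1 - + 2 * + (n ∸ k)       ∎
    where
    poly : ∀ x u → + 1 * + 1 + + 2 * (x - u) ≡ + 2 * x + + 1 - + 2 * u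
    poly = solve-∀

  -- An antidifference of `count₁ k`: summing 2 i + 1 over i < m gives M², and summing 2 (i ∸ k)
  -- gives U² - U.
  sum₁ : ℕ → ℕ → ℤ
  sum₁ k m = M * M - (U * U - U)
    where M = + m; U = + (m ∸ k)

  sum₁-step : ∀ k m → sum₁ k (suc m) ≡ sum₁ k m + + 1 * + count₁ k m
  sum₁-step k m = begin
    sum₁ k (suc m)
      ≡⟨ cong (λ t → (+ 1 + + m) * (+ 1 + + m) - t)
           (∸-telescope (λ u → u * u - u) (λ u → + 2 * u) square refl m k) ⟩
    (+ 1 + + m) * (+ 1 + + m) - (U * U - U + + 2 * U)
      ≡⟨ poly (+ m) U ⟩
    sum₁ k m + + 1 * (+ 2 * + m + + 1 - + 2 * U)
      ≡⟨ cong (λ t → sum₁ k m + + 1 * t) (count₁-formula k m) ⟨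
    sum₁ k m + + 1 * + count₁ k m ∎
    where
    U = + (m ∸ k)
    square : ∀ u → (+ 1 + u) * (+ 1 + u) - (+ 1 + u) ≡ u * u - u + + 2 * u
    square = solve-∀
    poly : ∀ x u → (+ 1 + x) * (+ 1 + x) - (u * u - u + + 2 * u) ≡
      x * x - (u * u - u) + + 1 * (+ 2 * x + + 1 - + 2 * u)
    poly = solve-∀

  ∸k∸k : ∀ n k → n ∸ k ∸ k ≡ n ∸ 2 ℕ.* k
  ∸k∸k n k = trans (ℕ.∸-+-assoc n k k) (cong (λ j → n ∸ (k ℕ.+ j)) (sym (ℕ.+-identityʳ k)))

  count₂-formula : ∀ k n → + count₂ k n ≡
    + 2 * (+ n * + n + + n) + + 1 - + 4 * (+ (n ∸ k) * + (n ∸ k))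
      + + 2 * (+ (n ∸ 2 ℕ.* k) * + (n ∸ 2 ℕ.* k) - + (n ∸ 2 ℕ.* k))
  count₂-formula k n = begin
    + count₂ k n
      ≡⟨ cong +_ (count-layers k ∣_∣ (interval k) n) ⟩
    + layers k (count₁ k) n
      ≡⟨ ℤ.*-identityˡ _ ⟨
    + 1 * + layers k (count₁ k) n
      ≡⟨ layers-formula (+ 1) (count₁ k) (sum₁ k) (sum₁-step k) k n ⟩
    + 1 * + count₁ k n + + 2 * (sum₁ k n - sum₁ k (n ∸ k))
      ≡⟨ cong₂ (λ s t → + 1 * s + + 2 * (sum₁ k n - (U * U - (+ t * + t - + t)))) (count₁-formula k n) (∸k∸k n k) ⟩
    + 1 * (+ 2 * + n + + 1 - + 2 * U) + + 2 * (sum₁ k n - (U * U - (V * V - V)))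
      ≡⟨ poly (+ n) U V ⟩
    + 2 * (+ n * + n + + n) + + 1 - + 4 * (U * U) + + 2 * (V * V - V) ∎
    where
    U = + (n ∸ k)
    V = + (n ∸ 2 ℕ.* k)
    poly : ∀ x u v →
      + 1 * (+ 2 * x + + 1 - + 2 * u) + + 2 * (x * x - (u * u - u) - (u * u - (v * v - v))) ≡
      + 2 * (x * x + x) + + 1 - + 4 * (u * u) + + 2 * (v * v - v)
    poly = solve-∀

  -- Three times, six times and six times the sums of 2 i² + 2 i + 1, i² and i (i - 1) / 2 over i < x.
  centred squares tetrahedral : ℤ → ℤ
  centred     x = + 2 * (x * x * x) + x
  squares     x = + 2 * (x * x * x) - + 3 * (x * x) + x
  tetrahedral x = x * x * x - + 3 * (x * x) + + 2 * x

  -- An antidifference of 3 `count₂ k`, term by term: the coefficient -4 of the square becomes -12 =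
  -- -2 · 6, and 3 · 2 (v² - v) is twice the increment 3 (v² - v) of `tetrahedral`.
  3sum₂ : ℕ → ℕ → ℤ
  3sum₂ k m = centred (+ m) - + 2 * squares (+ (m ∸ k)) + + 2 * tetrahedral (+ (m ∸ 2 ℕ.* k))

  3sum₂-step : ∀ k m → 3sum₂ k (suc m) ≡ 3sum₂ k m + + 3 * + count₂ k m
  3sum₂-step k m = begin
    3sum₂ k (suc m)
      ≡⟨ cong₂ (λ s t → centred (+ 1 + + m) - + 2 * s + + 2 * t)
           (∸-telescope squares (λ u → + 6 * (u * u)) squares-step refl m k)
           (∸-telescope tetrahedral (λ v → + 3 * (v * v - v)) tetrahedral-step refl m (2 ℕ.* k)) ⟩
    centred (+ 1 + + m) - + 2 * (squares U + + 6 * (U * U)) + + 2 * (tetrahedral V + + 3 * (V * V - V))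
      ≡⟨ poly (+ m) U V (squares U) (tetrahedral V) ⟩
    3sum₂ k m + + 3 * (+ 2 * (+ m * + m + + m) + + 1 - + 4 * (U * U) + + 2 * (V * V - V))
      ≡⟨ cong (λ t → 3sum₂ k m + + 3 * t) (count₂-formula k m) ⟨
    3sum₂ k m + + 3 * + count₂ k m ∎
    where
    U = + (m ∸ k)
    V = + (m ∸ 2 ℕ.* k)
    squares-step : ∀ u → + 2 * ((+ 1 + u) * (+ 1 + u) * (+ 1 + u)) - + 3 * ((+ 1 + u) * (+ 1 + u)) + (+ 1 + u) ≡
      + 2 * (u * u * u) - + 3 * (u * u) + u + + 6 * (u * u)
    squares-step = solve-∀
    tetrahedral-step : ∀ v →
      (+ 1 + v) * (+ 1 + v) * (+ 1 + v) - + 3 * ((+ 1 + v) * (+ 1 + v)) + + 2 * (+ 1 + v) ≡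
      v * v * v - + 3 * (v * v) + + 2 * v + + 3 * (v * v - v)
    tetrahedral-step = solve-∀
    poly : ∀ x u v s t →
      + 2 * ((+ 1 + x) * (+ 1 + x) * (+ 1 + x)) + (+ 1 + x) - + 2 * (s + + 6 * (u * u)) + + 2 * (t + + 3 * (v * v - v)) ≡
      + 2 * (x * x * x) + x - + 2 * s + + 2 * t
        + + 3 * (+ 2 * (x * x + x) + + 1 - + 4 * (u * u) + + 2 * (v * v - v))
    poly = solve-∀

  -- Inclusion-exclusion over the coordinates exceeding k in absolute value, multiplied by 3. The
  -- terms in x count the full octahedron; those in u, v and w account for one, two and three such
  -- coordinates.
  3count-poly : ℤ → ℤ → ℤ → ℤ → ℤ
  3count-poly x u v w = + 4 * (x * x * x) + + 6 * (x * x) + + 8 * x + + 3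
    - + 6 * (+ 2 * (u * u * u) + u)
    + + 6 * (v * (v - + 1) * (+ 2 * v - + 1))
    - + 4 * (w * (w - + 1) * (w - + 2))

  3count₃-formula : ∀ k n → + 3 * + count₃ k n ≡ 3count-poly (+ n) (+ (n ∸ k)) (+ (n ∸ 2 ℕ.* k)) (+ (n ∸ 3 ℕ.* k))
  3count₃-formula k n = begin
    + 3 * + count₃ k n
      ≡⟨ cong (λ t → + 3 * + t) (count-layers k (λ (y , z) → ∣ y ∣ ℕ.+ ∣ z ∣) (cartesianProduct (interval k) (interval k)) n) ⟩
    + 3 * + layers k (count₂ k) n
      ≡⟨ layers-formula (+ 3) (count₂ k) (3sum₂ k) (3sum₂-step k) k n ⟩
    + 3 * + count₂ k n + + 2 * (3sum₂ k n - 3sum₂ k (n ∸ k))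
      ≡⟨ cong₂ (λ s t → + 3 * + count₂ k n + + 2 * (3sum₂ k n -
           (centred U - + 2 * squares (+ s) + + 2 * tetrahedral (+ t))))
           -- Shifting by k turns n ∸ k into n ∸ 2k and n ∸ 2k into n ∸ 3k; `3 ℕ.* k` unfolds to
           -- `k ℕ.+ 2 ℕ.* k`.
           (∸k∸k n k) (ℕ.∸-+-assoc n k (2 ℕ.* k)) ⟩
    + 3 * + count₂ k n + + 2 * (3sum₂ k n - (centred U - + 2 * squares V + + 2 * tetrahedral W))
      ≡⟨ cong (λ s → + 3 * s + + 2 * (3sum₂ k n - (centred U - + 2 * squares V + + 2 * tetrahedral W)))
           (count₂-formula k n) ⟩
    + 3 * (+ 2 * (+ n * + n + + n) + + 1 - + 4 * (U * U) + + 2 * (V * V - V))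
      + + 2 * (3sum₂ k n - (centred U - + 2 * squares V + + 2 * tetrahedral W))
      ≡⟨ poly (+ n) U V W ⟩
    3count-poly (+ n) U V W ∎
    where
    U = + (n ∸ k)
    V = + (n ∸ 2 ℕ.* k)
    W = + (n ∸ 3 ℕ.* k)
    poly : ∀ x u v w →
      + 3 * (+ 2 * (x * x + x) + + 1 - + 4 * (u * u) + + 2 * (v * v - v))
        + + 2 * (+ 2 * (x * x * x) + x - + 2 * (+ 2 * (u * u * u) - + 3 * (u * u) + u)
                   + + 2 * (v * v * v - + 3 * (v * v) + + 2 * v)
                 - (+ 2 * (u * u * u) + u - + 2 * (+ 2 * (v * v * v) - + 3 * (v * v) + v)
                   + + 2 * (w * w * w - + 3 * (w * w) + + 2 * w))) ≡
      + 4 * (x * x * x) + + 6 * (x * x) + + 8 * x + + 3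
        - + 6 * (+ 2 * (u * u * u) + u)
        + + 6 * (v * (v - + 1) * (+ 2 * v - + 1))
        - + 4 * (w * (w - + 1) * (w - + 2))
    poly = solve-∀

  -- Resolving the truncated differences in the four cases.

  pos-∸ : ∀ {m n} → n ≤ m → + (m ∸ n) ≡ + m - + n
  pos-∸ {m} {n} n≤m = trans (sym (ℤ.⊖-≥ n≤m)) (sym (ℤ.m-n≡m⊖n m n))

  pos-∸-* : ∀ {m} c k → c ℕ.* k ≤ m → + (m ∸ c ℕ.* k) ≡ + m - + c * + k
  pos-∸-* {m} c k ck≤m = trans (pos-∸ ck≤m) (cong (λ t → + m - t) (ℤ.pos-* c k))

  pos-∸-≡0 : ∀ {m n} → m ≤ n → + (m ∸ n) ≡ + 0
  pos-∸-≡0 m≤n = cong +_ (ℕ.m≤n⇒m∸n≡0 m≤n)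

  3count-poly-cong : ∀ x {u u′ v v′ w w′} → u ≡ u′ → v ≡ v′ → w ≡ w′ → 3count-poly x u v w ≡ 3count-poly x u′ v′ w′
  3count-poly-cong x refl refl refl = refl

  -- The tests are split in the order of the conditionals of `formula`, so that each branch reduces
  -- to a single polynomial identity.
  3count-poly-formula : ∀ n k → 3count-poly (+ n) (+ (n ∸ k)) (+ (n ∸ 2 ℕ.* k)) (+ (n ∸ 3 ℕ.* k)) ≡ formula n k
  3count-poly-formula n k with n <? k
  ... | yes n<k = trans
    (3count-poly-cong N (pos-∸-≡0 n≤k) (pos-∸-≡0 (ℕ.≤-trans n≤k (ℕ.m≤m+n k _))) (pos-∸-≡0 (ℕ.≤-trans n≤k (ℕ.m≤m+n k _))))
    (poly N)
    where
    N = + n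
    n≤k = ℕ.<⇒≤ n<k
    -- Powers are written in the form to which `_^_` unfolds, so that the identity matches `formula`
    -- by computation.
    poly : ∀ x →
      + 4 * (x * x * x) + + 6 * (x * x) + + 8 * x + + 3
        - + 6 * (+ 2 * (+ 0 * + 0 * + 0) + + 0)
        + + 6 * (+ 0 * (+ 0 - + 1) * (+ 2 * + 0 - + 1))
        - + 4 * (+ 0 * (+ 0 - + 1) * (+ 0 - + 2)) ≡
      + 4 * (x * (x * (x * + 1))) + + 6 * (x * (x * + 1)) + + 8 * x + + 3
    poly = solve-∀
  ... | no n≮k with k ≤? n | n <? 2 ℕ.* k
  -- Failure of the previous strict test already gives this lower bound; the same holds for 2k
  -- below.
  ...   | no k≰n  | _        = contradiction (ℕ.≮⇒≥ n≮k) k≰n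
  ...   | yes k≤n | yes n<2k = trans
    (3count-poly-cong N (pos-∸ k≤n) (pos-∸-≡0 n≤2k) (pos-∸-≡0 (ℕ.≤-trans n≤2k (ℕ.m≤n+m _ k))))
    (poly N (+ k))
    where
    N = + n
    n≤2k = ℕ.<⇒≤ n<2k
    poly : ∀ x y →
      + 4 * (x * x * x) + + 6 * (x * x) + + 8 * x + + 3
        - + 6 * (+ 2 * ((x - y) * (x - y) * (x - y)) + (x - y))
        + + 6 * (+ 0 * (+ 0 - + 1) * (+ 2 * + 0 - + 1))
        - + 4 * (+ 0 * (+ 0 - + 1) * (+ 0 - + 2)) ≡
      + 12 * (y * (y * (y * + 1))) - + 36 * (y * (y * + 1)) * x + + 36 * y * (x * (x * + 1))
        - + 8 * (x * (x * (x * + 1))) + + 6 * (x * (x * + 1)) + + 6 * y + + 2 * x + + 3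
    poly = solve-∀
  ...   | yes k≤n | no n≮2k with 2 ℕ.* k ≤? n | n <? 3 ℕ.* k
  ...     | no 2k≰n  | _        = contradiction (ℕ.≮⇒≥ n≮2k) 2k≰n
  ...     | yes 2k≤n | yes n<3k = trans
    (3count-poly-cong N (pos-∸ k≤n) (pos-∸-* 2 k 2k≤n) (pos-∸-≡0 (ℕ.<⇒≤ n<3k)))
    (poly N (+ k))
    where
    N = + n
    poly : ∀ x y →
      + 4 * (x * x * x) + + 6 * (x * x) + + 8 * x + + 3
        - + 6 * (+ 2 * ((x - y) * (x - y) * (x - y)) + (x - y))
        + + 6 * ((x - + 2 * y) * (x - + 2 * y - + 1) * (+ 2 * (x - + 2 * y) - + 1))
        - + 4 * (+ 0 * (+ 0 - + 1) * (+ 0 - + 2)) ≡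
      - (+ 84) * (y * (y * (y * + 1))) + + 108 * (y * (y * + 1)) * x - + 36 * y * (x * (x * + 1))
        + + 4 * (x * (x * (x * + 1))) - + 72 * (y * (y * + 1)) + + 72 * x * y - + 12 * (x * (x * + 1))
        - + 6 * y + + 8 * x + + 3
    poly = solve-∀
  ...     | yes 2k≤n | no n≮3k = trans
    (3count-poly-cong N (pos-∸ k≤n) (pos-∸-* 2 k 2k≤n) (pos-∸-* 3 k (ℕ.≮⇒≥ n≮3k)))
    (poly N (+ k))
    where
    N = + n
    -- With no difference truncated, n cancels and 3 (2k + 1)³ remains, three times the size of the
    -- whole cube.
    poly : ∀ x y →
      + 4 * (x * x * x) + + 6 * (x * x) + + 8 * x + + 3
        - + 6 * (+ 2 * ((x - y) * (x - y) * (x - y)) + (x - y))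
        + + 6 * ((x - + 2 * y) * (x - + 2 * y - + 1) * (+ 2 * (x - + 2 * y) - + 1))
        - + 4 * ((x - + 3 * y) * (x - + 3 * y - + 1) * (x - + 3 * y - + 2)) ≡
      + 24 * (y * (y * (y * + 1))) + + 36 * (y * (y * + 1)) + + 18 * y + + 3
    poly = solve-∀

  3a⁽³⁾≡formula : ∀ n k → + 3 * + a⁽³⁾ n k ≡ formula n k
  3a⁽³⁾≡formula n k = begin
    + 3 * + a⁽³⁾ n k     ≡⟨ cong (λ t → + 3 * + t) (a⁽³⁾≡count₃ k n) ⟩
    + 3 * + count₃ k n   ≡⟨ 3count₃-formula k n ⟩
    _                    ≡⟨ 3count-poly-formula n k ⟩
    formula n k          ∎

-- Division by 3 in the rationals.

open import Data.Rational using (_/_; _*_)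

-- Among unnormalised rationals equality is cross multiplication, which turns the claim into the
-- integer hypothesis.
3*-solve : ∀ x y → + 3 Data.Integer.* x ≡ y → x / 1 ≡ (+ 1 / 3) * (y / 1)
3*-solve x y 3x≡y = toℚᵘ-injective (begin-≃
  toℚᵘ (x / 1)                               ≈⟨ toℚᵘ-fromℚᵘ (mkℚᵘ x 0) ⟩
  mkℚᵘ x 0                                   ≈⟨ *≡* cross ⟩
  -- `mkℚᵘ` stores the denominator minus one, so `mkℚᵘ (+ 1) 2` is 1/3.
  mkℚᵘ (+ 1) 2 ℚᵘ.* mkℚᵘ y 0                 ≈⟨ ℚᵘ.*-congˡ {mkℚᵘ (+ 1) 2} (toℚᵘ-fromℚᵘ (mkℚᵘ y 0)) ⟨
  toℚᵘ (+ 1 / 3) ℚᵘ.* toℚᵘ (y / 1)           ≈⟨ toℚᵘ-homo-* (+ 1 / 3) (y / 1) ⟨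
  toℚᵘ ((+ 1 / 3) * (y / 1))                 ∎≃)
  where
  open import Relation.Binary.Reasoning.Setoid ℚᵘ.≃-setoid
    renaming (begin_ to begin-≃_; _∎ to _∎≃)
    hiding (step-≡; step-≡-∣; step-≡-⟩; step-≡-⟨)
  open import Data.Integer using () renaming (_*_ to _ℤ*_)
  poly : ∀ z → z ℤ* + 3 ≡ + 1 ℤ* (+ 3 ℤ* z) ℤ* + 1
  poly = solve-∀
  cross : x ℤ* + 3 ≡ + 1 ℤ* y ℤ* + 1
  cross = trans (poly x) (cong (λ t → + 1 ℤ* t ℤ* + 1) 3x≡y)

corollary5 : (n k : ℕ) → (+ (a⁽³⁾ n k)) / 1 ≡ ((+ 1) / 3) * (formula n k / 1)
corollary5 n k = 3*-solve (+ a⁽³⁾ n k) (formula n k) (3a⁽³⁾≡formula n k)
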